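{- Let $G=(V,E)$ be a (finite or infinite) graph without isolated edge, and let $L=\{L_v:v\in V\}\cup\{L_e:e\in E\}$ be a set of lists of weights for $G$. For a subgraph $H$ of $G$, let $L_H$ denote the restriction of $L$ to $V(H)\cup E(H)$, i.e. $L_H=\{L_v:v\in V(H)\}\cup\{L_e:e\in E(H)\}$. If every finite induced subgraph $H$ of $G$ that is not isomorphic to $K_2$ has an $L_H$-weighting, then $G$ has an $L$-weighting.
   Context: Graphs are simple and may be infinite; an isolated edge is a connected component isomorphic to $K_2$. Each list is a finite subset of $\{1,\dots,k\}$ for some natural number $k$. For a graph $F$ and a set of lists $M=\{M_v:v\in V(F)\}\cup\{M_e:e\in E(F)\}$, a weighting of $F$ from $M$ is a function $\omega\colon V(F)\cup E(F)\to\mathbb{Z}_{>0}$ with $\omega(v)\in M_v$ and $\omega(e)\in M_e$ for all vertices $v$ and edges $e$ of $F$. The weighted degree of a vertex $v$ in $F$ is $s_\omega(v)=\sum_{w\in N_F(v)}\omega(vw)+\omega(v)$; if $v$ has infinite degree $\kappa$ in $F$ this sum is the cardinal $\kappa$. An $M$-weighting of $F$ is a weighting $\omega$ of $F$ from $M$ such that for every edge $uv$ of $F$, either $s_\omega(u)\neq s_\omega(v)$, or $u$ and $v$ have the same infinite degree in $F$. -}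

module Defs where

open import Level using (Level; 0ℓ; suc; _⊔_; Lift)
import Data.Nat.Properties as ℕ
open import Algebra.Properties.CommutativeMonoid.Sum
  ℕ.+-0-commutativeMonoid using (sum)
open import Axiom.ExcludedMiddle using (ExcludedMiddle)
open import Data.Bool.Base using (Bool; T)
open import Data.Bool.Properties using (T-irrelevant)
open import Data.Fin.Base using (Fin; toℕ)
import Data.Fin.Subset as Subset
open import Data.Nat.Base using (ℕ; _+_)
open import Data.Product.Base using (Σ; Σ-syntax; ∃-syntax; _×_; _,_; proj₁; proj₂)
open import Data.Sum.Base using (_⊎_)
open import Function.Base using (_on_; _∘_)
open import Function.Bundles using (_↔_; _⇔_; Inverse)
open import Relation.Binary.Construct.Closure.ReflexiveTransitive using (Star)
open import Relation.Binary.Core using (Rel)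
open import Relation.Binary.Definitions using (Symmetric; Irreflexive; Irrelevant)
open import Relation.Binary.PropositionalEquality.Core using (_≡_; _≢_; refl; ≢-sym)
open import Relation.Nullary.Decidable.Core using (Dec; yes; no)
open import Relation.Nullary.Negation.Core using (¬_)

private
  variable
    a b ℓ : Level

Finite : Set a → Set a
Finite A = ∃[ n ] (A ↔ Fin n)

-- Irrelevance of adjacency excludes parallel edges.
record Graph (ℓ : Level) : Set (suc ℓ) where
  infix 4 _~_
  field
    V            : Set ℓ
    _~_          : Rel V ℓ
    ~-sym        : Symmetric _~_
    ~-irrefl     : Irreflexive _≡_ _~_
    ~-irrelevant : Irrelevant _~_

  N : V → Set ℓ
  N v = Σ[ w ∈ V ] v ~ w

open Graph using (V; N)

record _≅_ (F : Graph a) (H : Graph b) : Set (a ⊔ b) where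
  private
    module F = Graph F
    module H = Graph H
  field
    bijection : F.V ↔ H.V
    adjacency : ∀ u v → (u F.~ v) ⇔ (Inverse.to bijection u H.~ Inverse.to bijection v)

complete : ℕ → Graph 0ℓ
complete n = record
  { V            = Fin n
  ; _~_          = _≢_
  ; ~-sym        = ≢-sym
  ; ~-irrefl     = λ i≡j i≢j → i≢j i≡j
  ; ~-irrelevant = λ _ _ → refl
  }

-- Vertex sets are given by characteristic functions; under excluded middle
-- every set of vertices has one.
VertexSet : Graph ℓ → Set ℓ
VertexSet G = V G → Bool

induced : (G : Graph ℓ) → VertexSet G → Graph ℓ
induced G S = record
  { V            = Σ[ v ∈ G.V ] T (S v)
  ; _~_          = G._~_ on proj₁
  ; ~-sym        = G.~-sym
  ; ~-irrefl     = λ { refl → G.~-irrefl refl }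
  ; ~-irrelevant = G.~-irrelevant
  }
  where module G = Graph G

IsComponent : (G : Graph ℓ) → VertexSet G → Set ℓ
IsComponent G S = ∃[ v ] ∀ w → T (S w) ⇔ Star (Graph._~_ G) v w

WithoutIsolatedEdge : Graph ℓ → Set ℓ
WithoutIsolatedEdge G = ∀ S → IsComponent G S → ¬ (induced G S ≅ complete 2)

-- A function on V(F) ∪ E(F).  A proof of u ~ v stands for the edge uv, so the
-- proofs of u ~ v and of v ~ u have to receive the same value.
record Labelling (F : Graph ℓ) (A : Set a) : Set (ℓ ⊔ a) where
  open Graph F using (_~_; ~-sym)
  field
    onV     : V F → A
    onE     : ∀ {u v} → u ~ v → A
    onE-sym : ∀ {u v} (e : u ~ v) → onE (~-sym e) ≡ onE e

restrict : ∀ {G : Graph ℓ} {A : Set a} (S : VertexSet G) →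
           Labelling G A → Labelling (induced G S) A
restrict S L = record
  { onV     = onV ∘ proj₁
  ; onE     = onE
  ; onE-sym = onE-sym
  }
  where open Labelling L

-- A natural number k and a subset of {1,…,k}; the index i : Fin k stands for
-- the weight 1 + i.  In particular, weights from a list are positive.
WeightList : Set
WeightList = ∃[ k ] Subset.Subset k

infix 4 _∈ᴸ_
_∈ᴸ_ : ℕ → WeightList → Set
x ∈ᴸ (k , S) = ∃[ i ] (x ≡ 1 + toℕ i × i Subset.∈ S)

record IsWeightingFrom {F : Graph ℓ} (M : Labelling F WeightList)
                       (ω : Labelling F ℕ) : Set ℓ where
  open Graph F using (_~_)
  private
    module M = Labelling M
    module ω = Labelling ω
  field
    onV-∈ : ∀ v → ω.onV v ∈ᴸ M.onV v
    onE-∈ : ∀ {u v} (e : u ~ v) → ω.onE e ∈ᴸ M.onE e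

-- Cardinals are represented by types, two types representing the same cardinal
-- when they are in bijection; Fin n represents the natural number n.
weightedDegree′ : {F : Graph ℓ} → Labelling F ℕ → (v : V F) → Dec (Finite (N F v)) → Set ℓ
weightedDegree′ {ℓ = ℓ} ω v (yes (n , N↔Fin)) =
  Lift ℓ (Fin (sum (λ i → onE (proj₂ (Inverse.from N↔Fin i))) + onV v))
  where open Labelling ω
weightedDegree′ {F = F} ω v (no _) = N F v

-- The metatheory is classical: excluded middle decides whether v has finite
-- degree.  As it also applies to types that are not propositions, it yields
-- choice, and with function extensionality the well-ordering theorem.
weightedDegree : ExcludedMiddle ℓ → {F : Graph ℓ} → Labelling F ℕ → V F → Set ℓ
weightedDegree em ω v = weightedDegree′ ω v em

SameInfiniteDegree : (F : Graph ℓ) → V F → V F → Set ℓ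
SameInfiniteDegree F u v = ¬ Finite (N F u) × ¬ Finite (N F v) × (N F u ↔ N F v)

record IsProperWeighting (em : ExcludedMiddle ℓ) {F : Graph ℓ}
                         (M : Labelling F WeightList) (ω : Labelling F ℕ) : Set ℓ where
  open Graph F using (_~_)
  field
    isWeightingFrom : IsWeightingFrom M ω
    proper          : ∀ {u v} → u ~ v →
                      ¬ (weightedDegree em ω u ↔ weightedDegree em ω v)
                      ⊎ SameInfiniteDegree F u v

-- F has an M-weighting.
HasWeighting : ExcludedMiddle ℓ → (F : Graph ℓ) → Labelling F WeightList → Set ℓ
HasWeighting em F M = Σ[ ω ∈ Labelling F ℕ ] IsProperWeighting em M ω

{-# OPTIONS --safe #-}
module Submission where

-- A vertex of infinite degree has an infinite cardinal as its weighted degree,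
-- whatever the weights are, so only edges whose two ends have finite degree can
-- be violated.  Each such constraint involves finitely many weights, and each
-- weight ranges over a finite list, so compactness reduces the theorem to
-- finitely many constraints at a time.  These are solved in the subgraph induced
-- by the finitely many vertices they involve, where the relevant degrees are the
-- same as in G; if this subgraph is K₂, it is not a component of G, so that
-- there is a further vertex to add to it.

open import Defs
import Data.Nat.Properties as ℕ
open import Algebra.Properties.CommutativeMonoid.Sum
  ℕ.+-0-commutativeMonoid using (sum; sum-permute; sum-cong-≗)
open import Axiom.ExcludedMiddle using (ExcludedMiddle)
open import Axiom.Extensionality.Propositional using (Extensionality; lower-extensionality)
open import Data.Bool.Base using (Bool; true; false; T)
open import Data.Bool.Properties using (T-irrelevant)
open import Data.Empty using (⊥; ⊥-elim)
open import Data.Fin.Base using (Fin; zero; suc)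
open import Data.Fin.Patterns using (0F; 1F)
open import Data.Fin.Permutation using (↔⇒≡)
import Data.Fin.Properties as Fin
open import Data.List.Base
  using (List; []; _∷_; _++_; map; lookup; tabulate; length; concatMap; deduplicate)
open import Data.List.Membership.Propositional using (_∈_)
open import Data.List.Membership.Propositional.Properties
  using (∈-++⁺ˡ; ∈-++⁺ʳ; ∈-lookup; ∈-tabulate⁺; ∈-concatMap⁺; ∈-deduplicate⁺; ∈-deduplicate⁻)
open import Data.List.Relation.Binary.Subset.Propositional using (_⊆_)
open import Data.List.Relation.Binary.Subset.Propositional.Properties using (∷⁺ʳ; xs⊆x∷xs)
open import Data.List.Relation.Unary.All as All using (All; []; _∷_)
import Data.List.Relation.Unary.All.Properties as All
open import Data.List.Relation.Unary.AllPairs using ([]; _∷_)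
open import Data.List.Relation.Unary.Any as Any using (here; there; index)
open import Data.List.Relation.Unary.Any.Properties using (lookup-index)
open import Data.List.Relation.Unary.Unique.DecPropositional.Properties using (deduplicate-!)
open import Data.List.Relation.Unary.Unique.Propositional using (Unique)
open import Data.Nat.Base using (ℕ; zero; suc; _+_; _<_; s≤s)
open import Data.Product.Base using (Σ; Σ-syntax; _×_; _,_; proj₁; proj₂)
open import Data.Sum.Base using (_⊎_; inj₁; inj₂)
open import Data.Unit.Base using (tt)
open import Function.Base using (_∘_; id)
open import Function.Bundles using (_↔_; _⇔_; mk⇔; mk↔ₛ′; Inverse; Equivalence)
open import Function.Properties.Inverse using (↔-refl; ↔-sym; ↔-trans)
open import Level using (Level; 0ℓ; Lift; lift; lower)
open import Relation.Binary.Construct.Closure.ReflexiveTransitive using (Star; ε; _◅_)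
open import Relation.Binary.Definitions using (DecidableEquality)
open import Relation.Binary.PropositionalEquality
  using (_≡_; _≢_; refl; sym; trans; cong; cong₂; subst)
open import Relation.Nullary.Decidable.Core
  using (Dec; yes; no; T?; ⌊_⌋; toWitness; fromWitness; decidable-stable)
open import Relation.Nullary.Negation.Core using (¬_; contradiction)

private
  variable
    a ℓ : Level
    A B : Set a

-- Classical logic and Boolean-valued sets.

T-extensional : ∀ {a b} → (T a → T b) → (T b → T a) → a ≡ b
T-extensional {false} {false} _ _ = refl
T-extensional {false} {true}  _ g = ⊥-elim (g tt)
T-extensional {true}  {false} f _ = ⊥-elim (f tt)
T-extensional {true}  {true}  _ _ = refl

module Classical {ℓ} (em : ExcludedMiddle ℓ) where

  stable : {A : Set ℓ} → ¬ ¬ A → A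
  stable = decidable-stable em

  ⟦_⟧ : {A : Set ℓ} → (A → Set ℓ) → A → Bool
  ⟦ Q ⟧ x = ⌊ em {Q x} ⌋

  ⟦⟧⁺ : {A : Set ℓ} (Q : A → Set ℓ) {x : A} → Q x → T (⟦ Q ⟧ x)
  ⟦⟧⁺ Q {x} = fromWitness {a? = em {Q x}}

  ⟦⟧⁻ : {A : Set ℓ} (Q : A → Set ℓ) {x : A} → T (⟦ Q ⟧ x) → Q x
  ⟦⟧⁻ Q {x} = toWitness {a? = em {Q x}}

-- Tukey's lemma by the Bourbaki–Witt argument: a step adds one compatible element,
-- the sets reached by steps and unions form a chain, and their union is a fixed
-- point.  Sets are Bool-valued so that sets of sets stay in Set ℓ, and steps can
-- choose an element because excluded middle produces witnesses.
module Tukey {ℓ} (em : ExcludedMiddle ℓ) (ext : Extensionality ℓ ℓ) {A : Set ℓ}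
  (P : List A → Set ℓ) (P-[] : P [])
  (P-anti : ∀ {xs ys} → xs ⊆ ys → P ys → P xs) where

  open Classical em

  Sub : Set ℓ
  Sub = A → Bool

  infix 4 _⊑_
  _⊑_ : Sub → Sub → Set ℓ
  s ⊑ t = ∀ {x} → T (s x) → T (t x)

  ⊑-antisym : ∀ {s t} → s ⊑ t → t ⊑ s → s ≡ t
  ⊑-antisym s⊑t t⊑s =
    -- Extensionality turns mutual inclusion into an equality that the chain argument can match on.
    lower-extensionality 0ℓ ℓ ext λ _ → T-extensional s⊑t t⊑s

  ⋃ : (Sub → Bool) → Sub
  ⋃ F = ⟦ (λ x → Σ[ s ∈ Sub ] T (F s) × T (s x)) ⟧

  ⊑-⋃ : ∀ F {s} → T (F s) → s ⊑ ⋃ F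
  ⊑-⋃ F Fs sx = ⟦⟧⁺ (λ x → Σ[ s ∈ Sub ] T (F s) × T (s x)) (_ , Fs , sx)

  ⋃⁻ : ∀ F {x} → T (⋃ F x) → Σ[ s ∈ Sub ] T (F s) × T (s x)
  ⋃⁻ F = ⟦⟧⁻ (λ x → Σ[ s ∈ Sub ] T (F s) × T (s x))

  ⋃-least : ∀ F {t} → (∀ {s} → T (F s) → s ⊑ t) → ⋃ F ⊑ t
  ⋃-least F F⊑t x∈ = let _ , Fs , sx = ⋃⁻ F x∈ in F⊑t Fs sx

  insert : A → Sub → Sub
  insert a s = ⟦ (λ x → T (s x) ⊎ x ≡ a) ⟧

  ⊑-insert : ∀ a s → s ⊑ insert a s
  ⊑-insert a s = ⟦⟧⁺ (λ x → T (s x) ⊎ x ≡ a) ∘ inj₁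

  ∈-insert : ∀ a s → T (insert a s a)
  ∈-insert a s = ⟦⟧⁺ (λ x → T (s x) ⊎ x ≡ a) (inj₂ refl)

  insert⁻ : ∀ a s {x} → T (insert a s x) → T (s x) ⊎ x ≡ a
  insert⁻ a s = ⟦⟧⁻ (λ x → T (s x) ⊎ x ≡ a)

  Good : Sub → Set ℓ
  Good s = ∀ l → All (T ∘ s) l → P l

  Compatible : Sub → A → Set ℓ
  Compatible s a = ∀ l → All (T ∘ s) l → P (a ∷ l)

  Extensible : Sub → Set ℓ
  Extensible s = Σ[ a ∈ A ] ¬ T (s a) × Compatible s a

  step′ : ∀ s → Dec (Extensible s) → Sub
  step′ s (yes (a , _)) = insert a s
  step′ s (no _)        = s

  step : Sub → Sub
  step s = step′ s em

  ⊑-step : ∀ s → s ⊑ step s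
  ⊑-step s with em {Extensible s}
  ... | yes (a , _) = ⊑-insert a s
  ... | no _        = id

  -- The empty set is the `limit` of the empty family. Families under `limit` are arbitrary, since
  -- all tower sets turn out to form a chain.
  data Tower : Sub → Set ℓ where
    next  : ∀ {s} → Tower s → Tower (step s)
    limit : ∀ F → (∀ {s} → T (F s) → Tower s) → Tower (⋃ F)

  Extreme : Sub → Set ℓ
  Extreme s = ∀ {t} → Tower t → t ⊑ s → t ≡ s ⊎ step t ⊑ s

  -- Induction on how `t` arises. Extremality keeps a step from a set below `s` from overshooting
  -- `s`; a union either has a member containing `step s` or consists of subsets of `s`.
  extreme-comparable : ∀ {s t} → Extreme s → Tower t → t ⊑ s ⊎ step s ⊑ t
  extreme-comparable ex (next {t} tw) with extreme-comparable ex tw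
  ... | inj₂ s⊑t = inj₂ (⊑-step t ∘ s⊑t)
  ... | inj₁ t⊑s with ex tw t⊑s
  ...   | inj₁ refl = inj₂ id
  ...   | inj₂ st⊑s = inj₁ st⊑s
  extreme-comparable {s} ex (limit F tws)
    with em {Σ[ t ∈ Sub ] T (F t) × (step s ⊑ t)}
  ... | yes (t , Ft , s⊑t) = inj₂ (⊑-⋃ F Ft ∘ s⊑t)
  ... | no ∄t = inj₁ (⋃-least F below)
    where
    below : ∀ {t} → T (F t) → t ⊑ s
    below {t} Ft with extreme-comparable ex (tws Ft)
    ... | inj₁ t⊑s = t⊑s
    ... | inj₂ s⊑t = contradiction (t , Ft , λ {x} → s⊑t {x}) ∄t

  -- Induction on how `s` arises. If `t` differs from a union above it, some member is not contained
  -- in `t`, and comparability puts `t` strictly below that extreme member.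
  tower-extreme : ∀ {s} → Tower s → Extreme s
  tower-extreme (next {s} tws) tw t⊑ with extreme-comparable (tower-extreme tws) tw
  ... | inj₂ s⊑t = inj₁ (⊑-antisym t⊑ s⊑t)
  ... | inj₁ t⊑s with tower-extreme tws tw t⊑s
  ...   | inj₁ refl = inj₂ id
  ...   | inj₂ st⊑s = inj₂ (⊑-step s ∘ st⊑s)
  tower-extreme (limit F tws) {t} tw t⊑
    with em {Σ[ s ∈ Sub ] T (F s) × ¬ (s ⊑ t)}
  ... | no ∄s = inj₁ (⊑-antisym t⊑ (⋃-least F λ {s} Fs →
          stable {A = s ⊑ t} λ s⋢t → ∄s (s , Fs , s⋢t)))
  ... | yes (s , Fs , s⋢t) with extreme-comparable (tower-extreme (tws Fs)) tw
  ...   | inj₂ ss⊑t = contradiction (λ {x} → ss⊑t {x} ∘ ⊑-step s) s⋢t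
  ...   | inj₁ t⊑s with tower-extreme (tws Fs) tw t⊑s
  ...     | inj₁ refl = contradiction (λ {x} → id) s⋢t
  ...     | inj₂ st⊑s = inj₂ (⊑-⋃ F Fs ∘ st⊑s)

  tower-chain : ∀ {s t} → Tower s → Tower t → s ⊑ t ⊎ t ⊑ s
  tower-chain {s} tws twt with extreme-comparable (tower-extreme tws) twt
  ... | inj₁ t⊑s  = inj₂ t⊑s
  ... | inj₂ ss⊑t = inj₁ (ss⊑t ∘ ⊑-step s)

  -- Of two members of a chain one contains the other, so finitely many elements share a member. The
  -- list is nonempty because `F` may be empty.
  ⋃-finite : ∀ F → (∀ {s} → T (F s) → Tower s) → ∀ a l → All (T ∘ ⋃ F) (a ∷ l) →
             Σ[ s ∈ Sub ] T (F s) × All (T ∘ s) (a ∷ l)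
  ⋃-finite F tws a [] (a∈ ∷ []) = let s , Fs , sa = ⋃⁻ F a∈ in s , Fs , sa ∷ []
  ⋃-finite F tws a (b ∷ l) (a∈ ∷ l∈) with ⋃⁻ F a∈ | ⋃-finite F tws b l l∈
  ... | s , Fs , sa | t , Ft , tl with tower-chain (tws Fs) (tws Ft)
  ...   | inj₁ s⊑t = t , Ft , s⊑t sa ∷ tl
  ...   | inj₂ t⊑s = s , Fs , sa ∷ All.map t⊑s tl

  -- Compatibility concerns `a` in front of a list from `s`, while `l` may contain `a` anywhere and
  -- repeatedly; `P-anti` absorbs the difference.
  delete-inserted : ∀ a s l → All (T ∘ insert a s) l →
                    Σ[ l′ ∈ List A ] All (T ∘ s) l′ × l ⊆ a ∷ l′
  delete-inserted a s [] [] = [] , [] , λ ()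
  delete-inserted a s (x ∷ l) (x∈ ∷ l∈)
    with insert⁻ a s x∈ | delete-inserted a s l l∈
  ... | inj₂ refl | l′ , l′∈ , l⊆ =
    l′ , l′∈ , λ { (here eq) → here eq ; (there y∈) → l⊆ y∈ }
  ... | inj₁ sx | l′ , l′∈ , l⊆ =
    x ∷ l′ , sx ∷ l′∈ , λ { (here eq) → there (here eq)
                          ; (there y∈) → ∷⁺ʳ a (xs⊆x∷xs l′ x) (l⊆ y∈) }

  tower-good : ∀ {s} → Tower s → Good s
  tower-good (next {s} tw) l l∈ with em {Extensible s}
  ... | no _ = tower-good tw l l∈
  ... | yes (a , _ , compatible) =
    let l′ , l′∈ , l⊆ = delete-inserted a s l l∈ in P-anti l⊆ (compatible l′ l′∈)
  tower-good (limit F tws) []      _  = P-[]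
  tower-good (limit F tws) (a ∷ l) l∈ =
    let s , Fs , sl = ⋃-finite F tws a l l∈ in tower-good (tws Fs) (a ∷ l) sl

  -- The union of the whole tower is itself a tower set, so it absorbs its own step.
  maximal : Sub
  maximal = ⋃ ⟦ Tower ⟧

  maximal-tower : Tower maximal
  maximal-tower = limit ⟦ Tower ⟧ (⟦⟧⁻ Tower)

  maximal-good : Good maximal
  maximal-good = tower-good maximal-tower

  maximal-fixed : step maximal ⊑ maximal
  maximal-fixed = ⊑-⋃ ⟦ Tower ⟧ (⟦⟧⁺ Tower (next maximal-tower))

  maximal-closed : ∀ a → Compatible maximal a → T (maximal a)
  -- `maximal-fixed` is matched alongside `em` so that `step maximal` reduces in its type.
  maximal-closed a compatible with em {Extensible maximal} | maximal-fixed
  ... | yes (b , b∉ , _) | fixed =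
    contradiction (fixed (∈-insert b maximal)) b∉
  ... | no ∄a | _ = decidable-stable (T? (maximal a)) λ a∉ → ∄a (a , a∉ , compatible)

-- Tukey's lemma is applied to finite partial functions, as lists of
-- (argument , value) pairs; boundedness makes the maximal one total.
module Compactness {ℓ} (em : ExcludedMiddle ℓ) (ext : Extensionality ℓ ℓ)
  {X C : Set ℓ} (bound : X → ℕ) (Sat : C → (X → ℕ) → Set ℓ) (supp : C → List X)
  (Sat-local : ∀ c {f g} → (∀ {x} → x ∈ supp c → f x ≡ g x) → Sat c f → Sat c g)
  (finitely-sat : ∀ D → Σ[ f ∈ (X → ℕ) ] (∀ x → f x < bound x) × All (λ c → Sat c f) D)
  where

  open Classical em

  Agrees : (X → ℕ) → X × ℕ → Set
  Agrees f (x , n) = f x ≡ n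

  Solves : List C → List (X × ℕ) → (X → ℕ) → Set ℓ
  Solves D l f = All (λ c → Sat c f) D × All (Agrees f) l

  Consistent : List (X × ℕ) → Set ℓ
  Consistent l = ∀ D → Σ[ f ∈ (X → ℕ) ] (∀ x → f x < bound x) × Solves D l f

  Consistent-[] : Consistent []
  Consistent-[] D = let f , f< , sat = finitely-sat D in f , f< , sat , []

  Consistent-anti : ∀ {xs ys} → xs ⊆ ys → Consistent ys → Consistent xs
  Consistent-anti xs⊆ys con D =
    let f , f< , sat , agr = con D in f , f< , sat , All.anti-mono xs⊆ys agr

  open Tukey em ext Consistent Consistent-[] Consistent-anti

  Refutation : X × ℕ → Set ℓ
  Refutation a = Σ[ l ∈ List (X × ℕ) ] All (T ∘ maximal) l ×
    (Σ[ D ∈ List C ] ¬ (Σ[ f ∈ (X → ℕ) ] (∀ x → f x < bound x) × Solves D (a ∷ l) f))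

  refute : ∀ {a} → ¬ T (maximal a) → Refutation a
  refute {a} a∉ = stable λ ¬ref → a∉ (maximal-closed a λ l l∈ D →
    stable λ ¬sol → ¬ref (l , l∈ , D , ¬sol))

  -- Refutations of the single values below `n` are merged by concatenating their assignments and
  -- constraints, which stay finite because `n` is.
  refute-below : ∀ x n → (∀ m → ¬ T (maximal (x , m))) →
    Σ[ l ∈ List (X × ℕ) ] All (T ∘ maximal) l ×
    (Σ[ D ∈ List C ] ∀ f → (∀ x → f x < bound x) → Solves D l f → ¬ (f x < n))
  refute-below x zero    x∉ = [] , [] , [] , λ _ _ _ ()
  refute-below x (suc n) x∉ with refute-below x n x∉ | refute (x∉ n)
  ... | l , l∈ , D , ¬below | l′ , l′∈ , D′ , ¬at =
    l ++ l′ , All.++⁺ l∈ l′∈ , D ++ D′ , λ f f< (sat , agr) fx≤n →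
      ¬below f f< (All.++⁻ˡ D sat , All.++⁻ˡ l agr)
        (ℕ.≤∧≢⇒< (ℕ.≤-pred fx≤n) λ fx≡n →
          ¬at (f , f< , All.++⁻ʳ D sat , fx≡n ∷ All.++⁻ʳ l agr))

  value : ∀ x → Σ[ n ∈ ℕ ] T (maximal (x , n))
  value x with em {Lift ℓ (Σ[ n ∈ ℕ ] T (maximal (x , n)))}
  ... | yes (lift v) = v
  ... | no ∄n =
    -- With `n` the bound of `x`, all admissible values are refuted at once, against `maximal-good`.
    let l , l∈ , D , ¬below = refute-below x (bound x) λ m m∈ → ∄n (lift (m , m∈))
        f , f< , sol = maximal-good l l∈ D
    in contradiction (f< x) (¬below f f< sol)

  -- Each constraint is checked alone: consistency of `g` on its support yields a solution of it
  -- agreeing with `g` there, and locality transfers this to `g`.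
  solution : Σ[ g ∈ (X → ℕ) ] ∀ c → Sat c g
  solution = g , λ c →
    let f , _ , sat , agr = maximal-good (map graph (supp c))
          (All.map⁺ (All.tabulate λ {x} _ → proj₂ (value x))) (c ∷ [])
    in Sat-local c (All.lookup (All.map⁻ agr)) (All.head sat)
    where
    g : X → ℕ
    g = proj₁ ∘ value
    graph : X → X × ℕ
    graph x = x , g x

-- Enumerations of finite sets and sums over them.

lookup-injective : ∀ {xs : List A} → Unique xs →
                   ∀ i j → lookup xs i ≡ lookup xs j → i ≡ j
lookup-injective (_  ∷ _) zero    zero    _  = refl
lookup-injective (x∉ ∷ _) zero    (suc j) eq =
  contradiction eq (All.lookup x∉ (∈-lookup j))
lookup-injective (x∉ ∷ _) (suc i) zero    eq =
  contradiction (sym eq) (All.lookup x∉ (∈-lookup i))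
lookup-injective (_  ∷ u) (suc i) (suc j) eq = cong suc (lookup-injective u i j eq)

finite-subset : DecidableEquality A → (S : A → Bool) (xs : List A) →
                (∀ {x} → T (S x) ⇔ x ∈ xs) → Finite (Σ[ x ∈ A ] T (S x))
finite-subset {A = A} _≟_ S xs S⇔ = length ys , mk↔ₛ′ to from to∘from from∘to
  where
  ys : List A
  ys = deduplicate _≟_ xs
  S⇒ : ∀ {x} → T (S x) → x ∈ ys
  S⇒ = ∈-deduplicate⁺ _≟_ ∘ Equivalence.to S⇔
  to : Σ[ x ∈ A ] T (S x) → Fin (length ys)
  to (_ , Sx) = index (S⇒ Sx)
  from : Fin (length ys) → Σ[ x ∈ A ] T (S x)
  from i = lookup ys i , Equivalence.from S⇔ (∈-deduplicate⁻ _≟_ xs (∈-lookup i))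
  to∘from : ∀ i → to (from i) ≡ i
  to∘from i = lookup-injective (deduplicate-! _≟_ xs) _ i
    (sym (lookup-index (S⇒ (proj₂ (from i)))))
  Σ-≡ : ∀ {x y} {p : T (S x)} {q : T (S y)} → x ≡ y → (x , p) ≡ (y , q)
  Σ-≡ {p = p} {q} refl = cong (_ ,_) (T-irrelevant p q)
  from∘to : ∀ p → from (to p) ≡ p
  from∘to (_ , Sx) = Σ-≡ (sym (lookup-index (S⇒ Sx)))

-- The enumerations differ by a permutation. Degrees in `G` and in an induced subgraph are summed
-- along unrelated enumerations.
sum-reindex : ∀ {m n} (b : A ↔ Fin m) (c : A ↔ Fin n) (φ : A → ℕ) →
              sum (φ ∘ Inverse.from b) ≡ sum (φ ∘ Inverse.from c)
sum-reindex b c φ = trans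
  (sum-permute (φ ∘ Inverse.from b) (↔-trans (↔-sym c) b))
  (sum-cong-≗ λ i → cong φ (Inverse.strictlyInverseʳ b (Inverse.from c i)))

Lift↔ : Lift ℓ A ↔ A
Lift↔ = mk↔ₛ′ lower lift (λ _ → refl) (λ _ → refl)

≡⇒↔ : A ≡ B → A ↔ B
≡⇒↔ refl = ↔-refl

module Weightings (em : ExcludedMiddle ℓ) (G : Graph ℓ) where

  open Classical em
  open Graph G

  _≟_ : DecidableEquality V
  _ ≟ _ = em

  -- Finite vertex sets and avoidance of K₂.

  vertexSet : List V → VertexSet G
  vertexSet vs = ⟦ _∈ vs ⟧

  vertexSet-⇔ : ∀ vs {v} → T (vertexSet vs v) ⇔ v ∈ vs
  vertexSet-⇔ vs = mk⇔ (⟦⟧⁻ (_∈ vs)) (⟦⟧⁺ (_∈ vs))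

  vertexSet-finite : ∀ vs → Finite (Graph.V (induced G (vertexSet vs)))
  vertexSet-finite vs = finite-subset _≟_ (vertexSet vs) vs (vertexSet-⇔ vs)

  K₂-vertex : ∀ {S} → induced G S ≅ complete 2 → Fin 2 → V
  K₂-vertex iso i = proj₁ (Inverse.from (_≅_.bijection iso) i)

  K₂-edge : ∀ {S} (iso : induced G S ≅ complete 2) → K₂-vertex iso 0F ~ K₂-vertex iso 1F
  K₂-edge iso = Equivalence.from (adjacency (from 0F) (from 1F)) λ eq →
    Fin.0≢1+n (trans (sym (strictlyInverseˡ 0F)) (trans eq (strictlyInverseˡ 1F)))
    where
    open _≅_ iso
    open Inverse bijection

  ¬three-vertices : ∀ {S} → induced G S ≅ complete 2 → ∀ {u v w} →
    T (S u) → T (S v) → T (S w) → u ≢ v → u ≢ w → v ≢ w → ⊥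
  ¬three-vertices {S} iso Su Sv Sw u≢v u≢w v≢w =
    two (to (_ , Su)) (to (_ , Sv)) (to (_ , Sw)) (u≢v ∘ inj) (u≢w ∘ inj) (v≢w ∘ inj)
    where
    open _≅_ iso
    open Inverse bijection
    inj : ∀ {x y} {p : T (S x)} {q : T (S y)} →
          to (x , p) ≡ to (y , q) → x ≡ y
    inj eq = cong proj₁ (trans (sym (strictlyInverseʳ (_ , _)))
      (trans (cong from eq) (strictlyInverseʳ (_ , _))))
    two : (i j k : Fin 2) → i ≢ j → i ≢ k → j ≢ k → ⊥
    two zero       zero       _          i≢j _   _   = i≢j refl
    two zero       (suc zero) zero       _   i≢k _   = i≢k refl
    two zero       (suc zero) (suc zero) _   _   j≢k = j≢k refl
    two (suc zero) zero       zero       _   _   j≢k = j≢k refl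
    two (suc zero) zero       (suc zero) _   i≢k _   = i≢k refl
    two (suc zero) (suc zero) _          i≢j _   _   = i≢j refl

  -- Any further vertex will do, adjacent or not, since three vertices exclude K₂. If there is none,
  -- `vs` contains all of `V` and its single edge is a component.
  avoid-K₂ : WithoutIsolatedEdge G → ∀ vs →
             Σ[ ws ∈ List V ] vs ⊆ ws × ¬ (induced G (vertexSet ws) ≅ complete 2)
  avoid-K₂ noIso vs with em {Lift ℓ (induced G (vertexSet vs) ≅ complete 2)}
  ... | no ¬K₂ = vs , id , ¬K₂ ∘ lift
  ... | yes (lift iso) with em {Σ[ w ∈ V ] ¬ T (vertexSet vs w)}
  ...   | yes (w , w∉) = w ∷ vs , there , λ iso′ →
    ¬three-vertices iso′ (enlarge (in-vs 0F)) (enlarge (in-vs 1F))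
      (⟦⟧⁺ (_∈ w ∷ vs) (here refl))
      (λ eq → ~-irrefl eq (K₂-edge iso)) (w∉′ 0F) (w∉′ 1F)
    where
    open _≅_ iso
    open Inverse bijection
    in-vs : ∀ i → T (vertexSet vs (K₂-vertex iso i))
    in-vs i = proj₂ (from i)
    enlarge : ∀ {v} → T (vertexSet vs v) → T (vertexSet (w ∷ vs) v)
    enlarge = ⟦⟧⁺ (_∈ w ∷ vs) ∘ there ∘ ⟦⟧⁻ (_∈ vs)
    w∉′ : ∀ i → K₂-vertex iso i ≢ w
    w∉′ i refl = w∉ (in-vs i)
  ...   | no ∄w = contradiction iso (noIso (vertexSet vs) (u , λ w →
    mk⇔ (λ w∈ → subst (Star _~_ u ∘ proj₁) (strictlyInverseʳ (w , w∈)) (reach (to (w , w∈))))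
        (λ _ → spanning w)))
    where
    open _≅_ iso
    open Inverse bijection
    u : V
    u = K₂-vertex iso 0F
    spanning : ∀ w → T (vertexSet vs w)
    spanning w = decidable-stable (T? _) λ w∉ → ∄w (w , w∉)
    reach : ∀ i → Star _~_ u (K₂-vertex iso i)
    reach zero       = ε
    reach (suc zero) = K₂-edge iso ◅ ε

  -- Coordinates, degrees and supports.

  -- Edges are counted once per orientation; Sat makes the two weights agree.
  Coordinate : Set ℓ
  Coordinate = V ⊎ Σ V N

  degree : (Coordinate → ℕ) → ∀ u → Finite (N u) → ℕ
  degree f u (_ , N↔Fin) = sum (λ i → f (inj₂ (u , Inverse.from N↔Fin i))) + f (inj₁ u)

  incident′ : ∀ u → Dec (Finite (N u)) → List Coordinate
  incident′ u (yes (_ , N↔Fin)) = inj₁ u ∷ tabulate (λ i → inj₂ (u , Inverse.from N↔Fin i))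
  -- No degree condition reads the edges at a vertex of infinite degree.
  incident′ u (no _)            = inj₁ u ∷ []

  incident : V → List Coordinate
  incident u = incident′ u em

  ∈-incident-self : ∀ u → inj₁ u ∈ incident u
  ∈-incident-self u with em {Finite (N u)}
  ... | yes _ = here refl
  ... | no _  = here refl

  ∈-incident : ∀ {u} → Finite (N u) → ∀ p → inj₂ (u , p) ∈ incident u
  ∈-incident {u} fin p with em {Finite (N u)}
  ... | no ¬fin = contradiction fin ¬fin
  ... | yes (_ , N↔Fin) = there (subst (λ q → inj₂ (u , q) ∈ tabulate _)
          (Inverse.strictlyInverseʳ N↔Fin p) (∈-tabulate⁺ (Inverse.to N↔Fin p)))

  degree-local : ∀ {f g} u → (∀ {x} → x ∈ incident u → f x ≡ g x) →
                 ∀ fin → degree f u fin ≡ degree g u fin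
  degree-local {f} {g} u f≗g fin@(_ , N↔Fin) = cong₂ _+_
    (sum-cong-≗ {x = λ i → f (inj₂ (u , from i))} {y = λ i → g (inj₂ (u , from i))}
      λ i → f≗g (∈-incident fin (from i)))
    (f≗g (∈-incident-self u))
    where open Inverse N↔Fin using (from)

  induced-N : ∀ S {u} (Su : T (S u)) → (∀ ((w , _) : N u) → T (S w)) →
              Graph.N (induced G S) (u , Su) ↔ N u
  induced-N S Su N⊆S = mk↔ₛ′ (λ ((w , _) , e) → w , e) (λ (w , e) → (w , N⊆S (w , e)) , e)
    (λ _ → refl)
    (λ ((w , Sw) , e) → cong (λ p → (w , p) , e) (T-irrelevant _ Sw))

  ends : Coordinate → List V
  ends (inj₁ v)           = v ∷ []
  ends (inj₂ (u , v , _)) = u ∷ v ∷ []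

  -- The ends of these coordinates include all neighbours of an end of finite degree, so an induced
  -- subgraph containing them preserves that degree.
  support : Coordinate → List Coordinate
  support (inj₁ v)           = inj₁ v ∷ []
  support (inj₂ (u , v , e)) =
    inj₂ (u , v , e) ∷ inj₂ (v , u , ~-sym e) ∷ incident u ++ incident v

  -- Extension by zero from an induced subgraph.

  module Extend (S : VertexSet G) (ω : Labelling (induced G S) ℕ) where
    private module ω = Labelling ω

    extend : Coordinate → ℕ
    extend (inj₁ v) with T? (S v)
    ... | yes Sv = ω.onV (v , Sv)
    -- 0 belongs to no list but respects `bound`, which is all that is asked of values outside `S`.
    ... | no _   = 0
    extend (inj₂ (u , v , e)) with T? (S u) | T? (S v)
    ... | yes Su | yes Sv = ω.onE {u , Su} {v , Sv} e
    ... | _      | _      = 0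

    extend-V : ∀ {v} (Sv : T (S v)) → extend (inj₁ v) ≡ ω.onV (v , Sv)
    extend-V {v} Sv with T? (S v)
    ... | yes Sv′ = cong (λ p → ω.onV (v , p)) (T-irrelevant Sv′ Sv)
    ... | no ¬Sv  = contradiction Sv ¬Sv

    extend-E : ∀ {u v} (Su : T (S u)) (Sv : T (S v)) (e : u ~ v) →
               extend (inj₂ (u , v , e)) ≡ ω.onE {u , Su} {v , Sv} e
    extend-E {u} {v} Su Sv e with T? (S u) | T? (S v)
    ... | yes Su′ | yes Sv′ =
      cong₂ (λ p q → ω.onE {u , p} {v , q} e) (T-irrelevant Su′ Su) (T-irrelevant Sv′ Sv)
    ... | no ¬Su  | _       = contradiction Su ¬Su
    ... | yes _   | no ¬Sv  = contradiction Sv ¬Sv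

    -- All neighbours lie in `S`, so the two neighbourhoods are in bijection; this excludes the
    -- infinite case and matches the sums by reindexing.
    weightedDegree-extend :
      ∀ {u} (Su : T (S u)) → (∀ ((w , _) : N u) → T (S w)) → (fin : Finite (N u)) →
      (dec : Dec (Finite (Graph.N (induced G S) (u , Su)))) →
      weightedDegree′ ω (u , Su) dec ≡ Lift ℓ (Fin (degree extend u fin))
    weightedDegree-extend Su N⊆S (_ , N↔Fin) (no ¬fin) =
      contradiction (_ , ↔-trans (induced-N S Su N⊆S) N↔Fin) ¬fin
    weightedDegree-extend {u} Su N⊆S (_ , N↔Fin) (yes (_ , N′↔Fin)) =
      cong (Lift ℓ ∘ Fin) (cong₂ _+_
        (trans
          (sum-cong-≗ λ i → let (_ , Sw) , e = Inverse.from N′↔Fin i in sym (extend-E Su Sw e))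
          (sum-reindex (↔-trans (↔-sym (induced-N S Su N⊆S)) N′↔Fin) N↔Fin
            (λ p → extend (inj₂ (u , p)))))
        (sym (extend-V Su)))

  -- The constraint system.

  module Constraints (L : Labelling G WeightList) where
    private module L = Labelling L

    -- `suc` admits all weights up to `k` under the strict inequality, and the default 0 even for
    -- `k = 0`.
    bound : Coordinate → ℕ
    bound (inj₁ v)           = suc (proj₁ (L.onV v))
    bound (inj₂ (_ , _ , e)) = suc (proj₁ (L.onE e))

    ∈ᴸ⇒< : ∀ {n M} → n ∈ᴸ M → n < suc (proj₁ M)
    ∈ᴸ⇒< (i , refl , _) = s≤s (Fin.toℕ<n i)

    -- A coordinate also indexes the constraint it is subject to.
    Sat : Coordinate → (Coordinate → ℕ) → Set ℓ
    Sat (inj₁ v) f = Lift ℓ (f (inj₁ v) ∈ᴸ L.onV v)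
    Sat (inj₂ (u , v , e)) f =
      f (inj₂ (u , v , e)) ∈ᴸ L.onE e ×
      f (inj₂ (v , u , ~-sym e)) ≡ f (inj₂ (u , v , e)) ×
      (∀ finᵤ finᵥ → degree f u finᵤ ≢ degree f v finᵥ)

    Sat-local : ∀ c {f g} → (∀ {x} → x ∈ support c → f x ≡ g x) → Sat c f → Sat c g
    Sat-local (inj₁ v) f≗g (lift f∈) = lift (subst (_∈ᴸ L.onV v) (f≗g (here refl)) f∈)
    Sat-local (inj₂ (u , v , e)) f≗g (f∈ , f-sym , f-proper) =
      subst (_∈ᴸ L.onE e) (f≗g (here refl)) f∈ ,
      trans (sym (f≗g (there (here refl)))) (trans f-sym (f≗g (here refl))) ,
      λ finᵤ finᵥ eq → f-proper finᵤ finᵥ (trans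
        (degree-local u (f≗g ∘ there ∘ there ∘ ∈-++⁺ˡ) finᵤ)
        (trans eq (sym (degree-local v (f≗g ∘ there ∘ there ∘ ∈-++⁺ʳ (incident u)) finᵥ))))

    labelling : (f : Coordinate → ℕ) → (∀ c → Sat c f) → Labelling G ℕ
    labelling f sat = record
      { onV     = f ∘ inj₁
      ; onE     = λ {u} {v} e → f (inj₂ (u , v , e))
      ; onE-sym = λ {u} {v} e → proj₁ (proj₂ (sat (inj₂ (u , v , e))))
      }

    -- The degree constraint is vacuous if an end has infinite degree. Then a finite degree at the
    -- other end differs as a cardinal, and two infinite degrees are either equal or different
    -- cardinals.
    labelling-proper : ∀ f sat → IsProperWeighting em L (labelling f sat)
    labelling-proper f sat = record
      { isWeightingFrom = record
        { onV-∈ = λ v → lower (sat (inj₁ v))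
        ; onE-∈ = λ {u} {v} e → proj₁ (sat (inj₂ (u , v , e)))
        }
      ; proper = λ {u} {v} e → proper′ e em em
      }
      where
      ω : Labelling G ℕ
      ω = labelling f sat
      proper′ : ∀ {u v} → u ~ v → (decᵤ : Dec (Finite (N u))) (decᵥ : Dec (Finite (N v))) →
                ¬ (weightedDegree′ ω u decᵤ ↔ weightedDegree′ ω v decᵥ) ⊎ SameInfiniteDegree G u v
      proper′ {u} {v} e (yes finᵤ) (yes finᵥ) = inj₁ λ deg↔ →
        proj₂ (proj₂ (sat (inj₂ (u , v , e)))) finᵤ finᵥ
          (↔⇒≡ (↔-trans (↔-sym Lift↔) (↔-trans deg↔ Lift↔)))
      proper′ e (yes finᵤ) (no ¬finᵥ) = inj₁ λ deg↔ →
        ¬finᵥ (_ , ↔-trans (↔-sym deg↔) Lift↔)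
      proper′ e (no ¬finᵤ) (yes finᵥ) = inj₁ λ deg↔ → ¬finᵤ (_ , ↔-trans deg↔ Lift↔)
      proper′ {u} {v} e (no ¬finᵤ) (no ¬finᵥ) with em {N u ↔ N v}
      ... | yes N↔N = inj₂ (¬finᵤ , ¬finᵥ , N↔N)
      ... | no ¬N↔N = inj₁ ¬N↔N

    module _ (S : VertexSet G) (ω : Labelling (induced G S) ℕ)
             (ω-proper : IsProperWeighting em (restrict S L) ω) where
      open Extend S ω
      open IsProperWeighting ω-proper
      open IsWeightingFrom isWeightingFrom

      extend-bounded : ∀ x → extend x < bound x
      extend-bounded (inj₁ v) with T? (S v)
      ... | yes Sv = ∈ᴸ⇒< (onV-∈ (v , Sv))
      ... | no _   = ℕ.0<1+n
      extend-bounded (inj₂ (u , v , e)) with T? (S u) | T? (S v)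
      ... | yes Su | yes Sv = ∈ᴸ⇒< (onE-∈ {u , Su} {v , Sv} e)
      ... | yes _  | no _   = ℕ.0<1+n
      ... | no _   | _      = ℕ.0<1+n

      extend-sat : ∀ c → (∀ {x v} → x ∈ support c → v ∈ ends x → T (S v)) → Sat c extend
      extend-sat (inj₁ v) inside =
        lift (subst (_∈ᴸ L.onV v) (sym (extend-V Sv)) (onV-∈ (v , Sv)))
        where
        Sv : T (S v)
        Sv = inside (here refl) (here refl)
      extend-sat (inj₂ (u , v , e)) inside =
        subst (_∈ᴸ L.onE e) (sym (extend-E Su Sv e)) (onE-∈ {u , Su} {v , Sv} e) ,
        trans (extend-E Sv Su (~-sym e))
          (trans (Labelling.onE-sym ω {u , Su} {v , Sv} e) (sym (extend-E Su Sv e))) ,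
        degrees-differ
        where
        Su : T (S u)
        Su = inside (here refl) (here refl)
        Sv : T (S v)
        Sv = inside (here refl) (there (here refl))
        Nu⊆S : Finite (N u) → ∀ ((w , _) : N u) → T (S w)
        Nu⊆S fin p =
          inside (there (there (∈-++⁺ˡ (∈-incident fin p)))) (there (here refl))
        Nv⊆S : Finite (N v) → ∀ ((w , _) : N v) → T (S w)
        Nv⊆S fin p =
          inside (there (there (∈-++⁺ʳ (incident u) (∈-incident fin p)))) (there (here refl))
        degrees-differ : ∀ finᵤ finᵥ → degree extend u finᵤ ≢ degree extend v finᵥ
        degrees-differ finᵤ@(n , N↔Fin) finᵥ eq with proper {u , Su} {v , Sv} e
        -- `u` has finite degree in `G`, hence also in the induced subgraph.
        ... | inj₂ (¬fin , _) = ¬fin (n , ↔-trans (induced-N S Su (Nu⊆S finᵤ)) N↔Fin)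
        ... | inj₁ ¬deg↔ = ¬deg↔ (≡⇒↔ (trans
          (weightedDegree-extend Su (Nu⊆S finᵤ) finᵤ em)
          (trans (cong (Lift ℓ ∘ Fin) eq)
            (sym (weightedDegree-extend Sv (Nv⊆S finᵥ) finᵥ em)))))

theorem5 : ∀ {ℓ} (em : ExcludedMiddle ℓ) → Extensionality ℓ ℓ →
    (G : Graph ℓ) → WithoutIsolatedEdge G →
    (L : Labelling G WeightList) →
    ((S : VertexSet G) → Finite (Graph.V (induced G S)) →
    ¬ (induced G S ≅ complete 2) →
    HasWeighting em (induced G S) (restrict S L)) →
    HasWeighting em G L
theorem5 em ext G noIsolatedEdge L weighting = labelling g g-sat , labelling-proper g g-sat
  where
  open Weightings em G
  open Constraints L
  finitely-sat : ∀ D → Σ[ f ∈ (Coordinate → ℕ) ]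
    (∀ x → f x < bound x) × All (λ c → Sat c f) D
  finitely-sat D =
    -- The vertices touched by the constraints in `D`, with one more added if they induce K₂.
    let ws , vs⊆ws , ¬K₂ = avoid-K₂ noIsolatedEdge (concatMap ends (concatMap support D))
        S = vertexSet ws
        ω , ω-proper = weighting S (vertexSet-finite ws) ¬K₂
    in _ , extend-bounded S ω ω-proper , All.tabulate λ c∈ →
         extend-sat S ω ω-proper _ λ x∈ v∈ → Equivalence.from (vertexSet-⇔ ws)
           (vs⊆ws (∈-concatMap⁺ ends (Any.map (λ { refl → v∈ })
             (∈-concatMap⁺ support (Any.map (λ { refl → x∈ }) c∈)))))
  open Compactness em ext bound Sat support Sat-local finitely-sat
  g : Coordinate → ℕ
  g = proj₁ solution
  g-sat : ∀ c → Sat c g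
  g-sat = proj₂ solution
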